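{- Let $k$ be a non-negative integer. For every positive integer $d$, there exists a tree $T$ such that $\zeta_k(T)>d$.
   Context: Trees are finite. The $k$-visibility Localization game on a finite connected graph $G$ ($k\ge 0$ an integer) with $m$ cops: the robber first chooses a vertex of $G$. Then in each round the cops choose any vertices $u_1,\dots,u_m$ (no restriction relative to earlier placements), and cop $i$ receives the probe $d_i=d(u_i,x)$ if the robber's vertex $x$ satisfies $d(u_i,x)\le k$, and $d_i=\ast$ (no information) otherwise; afterwards the robber moves to a neighboring vertex or stays in place. A candidate is a vertex the robber may occupy, consistent with the information obtained so far. The cops win if they have a strategy that, whatever the robber does, determines after finitely many rounds a unique candidate (the robber is omniscient and knows the cops' entire strategy). The $k$-visibility localization number $\zeta_k(G)$ is the least positive integer $m$ for which $m$ cops have a winning strategy. -}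

module Defs where

open import Data.Fin using (Fin; zero; suc; inject₁; fromℕ)
open import Data.Fin.Properties using (any?; _≟_)
open import Data.List using (List; []; _∷_)
open import Data.Maybe using (Maybe; just; nothing)
open import Data.Nat using (ℕ; zero; suc; _≤_; _<_; _≤?_; z≤n; s≤s)
open import Data.Product using (Σ-syntax; ∃; ∃-syntax; ∃!; _×_; _,_; proj₁)
open import Data.Sum using (_⊎_)
open import Data.Vec using (Vec; map)
open import Function using (_∘_)
open import Function.Definitions using (Injective)
open import Level using (0ℓ)
open import Relation.Binary using (Rel; Symmetric; Irreflexive) renaming (Decidable to Decidable₂)
open import Relation.Binary.PropositionalEquality using (_≡_; refl)
open import Relation.Nullary using (yes; no; ¬_; contradiction)
open import Relation.Nullary.Decidable using (map′; _×-dec_)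
open import Relation.Unary using (Pred; Decidable)

IsLeast : Pred ℕ 0ℓ → Pred ℕ 0ℓ
IsLeast P m = P m × (∀ {j} → P j → m ≤ j)

least : {P : Pred ℕ 0ℓ} → Decidable P → ∀ n → P n → ∃ (IsLeast P)
least P? zero p = 0 , p , λ _ → z≤n
least {P} P? (suc n) p with P? 0
... | yes p₀ = 0 , p₀ , λ _ → z≤n
... | no ¬p₀ with least (P? ∘ suc) n p
...   | m , pm , m-min = suc m , pm , suc-min _
  where
  suc-min : ∀ j → P j → suc m ≤ j
  suc-min zero    p₀ = contradiction p₀ ¬p₀
  suc-min (suc j) pj = s≤s (m-min pj)

record Graph : Set₁ where
  field
    order  : ℕ
    Adj    : Rel (Fin order) 0ℓ
    adj?   : Decidable₂ Adj
    sym    : Symmetric Adj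
    irrefl : Irreflexive _≡_ Adj

  Vertex : Set
  Vertex = Fin order

  data Walk : ℕ → Rel Vertex 0ℓ where
    []  : ∀ {u} → Walk 0 u u
    _∷_ : ∀ {r u v w} → Adj u v → Walk r v w → Walk (suc r) u w

  walk? : ∀ u v → Decidable (λ r → Walk r u v)
  walk? u v zero    = map′ (λ { refl → [] }) (λ { [] → refl }) (u ≟ v)
  walk? u v (suc r) =
    map′ (λ { (_ , a , p) → a ∷ p }) (λ { (a ∷ p) → _ , a , p })
         (any? λ w → adj? u w ×-dec walk? w v r)

record IsConnected (G : Graph) : Set where
  open Graph G
  field
    nonEmpty  : 0 < order
    connected : ∀ u v → ∃[ r ] Walk r u v

  dist : Vertex → Vertex → ℕ
  dist u v = let r , p = connected u v in proj₁ (least (walk? u v) r p)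

record Cycle (G : Graph) : Set where
  open Graph G
  field
    excess   : ℕ
    vertices : Fin (suc (suc (suc excess))) → Vertex
    distinct : Injective _≡_ _≡_ vertices
    steps    : ∀ i → Adj (vertices (inject₁ i)) (vertices (suc i))
    closes   : Adj (vertices (fromℕ _)) (vertices zero)

record IsTree (G : Graph) : Set where
  field
    isConnected : IsConnected G
    acyclic     : ¬ Cycle G

module LocalizationGame (k : ℕ) {G : Graph} (conn : IsConnected G) where
  open Graph G
  open IsConnected conn

  -- The answer ∗ is represented by nothing.
  probe : Vertex → Vertex → Maybe ℕ
  probe x u with dist u x ≤? k
  ... | yes _ = just (dist u x)
  ... | no  _ = nothing

  Answers : ℕ → Set
  Answers m = Vec (Maybe ℕ) m

  -- The argument lists the answers of the earlier rounds, most recent first.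
  -- The earlier placements need not be recorded, as the strategy determines
  -- them from these answers.
  Strategy : ℕ → Set
  Strategy m = List (Answers m) → Vec Vertex m

  Move : Rel Vertex 0ℓ
  Move x y = x ≡ y ⊎ Adj x y

  -- The robber's moves so far, indexed by his current vertex.
  data Trajectory : Vertex → Set where
    start : ∀ x → Trajectory x
    _▷_   : ∀ {x y} → Trajectory x → Move x y → Trajectory y

  -- Each vertex of the trajectory, the current one included, has been probed.
  answers : ∀ {m x} → Strategy m → Trajectory x → List (Answers m)
  answers σ (start x)         = map (probe x) (σ []) ∷ []
  answers σ (_▷_ {y = y} τ _) = map (probe y) (σ (answers σ τ)) ∷ answers σ τ

  Candidate : ∀ {m} → Strategy m → List (Answers m) → Vertex → Set
  Candidate σ h y = Σ[ τ ∈ Trajectory y ] answers σ τ ≡ h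

  -- Every continuation of the trajectory reaches, after finitely many rounds,
  -- a unique candidate.  The inductive definition, rather than a quantifier
  -- over infinite plays, expresses this constructively; as the robber has
  -- finitely many moves available, the two agree classically.
  data Succeeds {m} (σ : Strategy m) {x} (τ : Trajectory x) : Set where
    located  : ∃! _≡_ (Candidate σ (answers σ τ)) → Succeeds σ τ
    continue : (∀ {y} (mv : Move x y) → Succeeds σ (τ ▷ mv)) → Succeeds σ τ

  CopsWin : ℕ → Set
  CopsWin m = Σ[ σ ∈ Strategy m ] (∀ x → Succeeds σ (start x))

  -- IsLocalizationNumber m means ζ_k(G) = m.
  IsLocalizationNumber : ℕ → Set
  IsLocalizationNumber = IsLeast (λ m → 0 < m × CopsWin m)

open LocalizationGame public using (IsLocalizationNumber)

{-# OPTIONS --safe #-}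
-- The cops' knowledge between rounds is the set of vertices where the robber may
-- be.  This turns the game into a reachability game on finitely many sets, so
-- that it is decidable whether m cops win, and the localization number exists.
--
-- For the lower bound the robber stays out of sight.  On a complete binary tree
-- a ball of radius k has boundedly many vertices, so d cops remove at most some
-- constant number D of candidates per round, and it suffices that, for some s,
-- every set of at least s vertices gains enough vertices in one move to have at
-- least s + D.  Take s close to a third of the tree.  If a set of about s
-- vertices had fewer than 3 D bichromatic edges (edges that leave it), then in a
-- tall tree some band of g consecutive levels would contain none of them.
-- Each subtree rooted at the top of the band would then be almost entirely
-- inside or almost entirely outside the set, whose size would be close to a
-- multiple of the size of such a subtree.  But a third of 2 ^ n is far from
-- every multiple of 2 ^ q, q ≤ n.
module Submission where

import Algebra.Properties.CommutativeMonoid.Sum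
open import Data.Bool using (Bool; true; false; T; _∧_; not; _xor_)
open import Data.Bool.Properties using (T?; xor-same)
open import Data.Empty using (⊥; ⊥-elim)
open import Data.Fin
  using (Fin; zero; suc; toℕ; fromℕ; fromℕ<; inject₁; splitAt; _↑ˡ_; _↑ʳ_; finToFun; funToFin)
open import Data.Fin.Patterns using (0F; 1F)
open import Data.Fin.Properties
  using (any?; all?; _≟_; finToFun-funToFin; suc-injective; toℕ-inject₁; toℕ-↑ˡ; toℕ-↑ʳ;
         splitAt-↑ˡ; splitAt-↑ʳ; splitAt⁻¹-↑ˡ; splitAt⁻¹-↑ʳ)
open import Data.Fin.Relation.Unary.Top using (view; ‵fromℕ; ‵inject₁)
open import Data.List using (List; []; _∷_; length; concatMap)
import Data.List as List
import Data.List.Properties as List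
open import Data.List.Membership.Propositional using (_∈_)
open import Data.List.Membership.Propositional.Properties using (∈-map⁺; ∈-concatMap⁺)
open import Data.List.Relation.Unary.Any using (here; there)
import Data.List.Relation.Unary.Any as Any
open import Data.Maybe using (just; nothing)
import Data.Maybe.Properties as Maybe
open import Data.Nat
  using (ℕ; zero; suc; _+_; _*_; _^_; _∸_; _/_; _%_; _⊔_; _≤_; _<_; _≤?_; z≤n; s≤s; s≤s⁻¹)
open import Data.Nat.Coprimality using (coprime-divisor; coprime?)
open import Data.Nat.Divisibility using (_∣_; divides; ∣⇒≤)
open import Data.Nat.DivMod using (m≡m%n+[m/n]*n; m%n<n; m/n*n≤m)
open import Data.Nat.Properties hiding (_≟_; suc-injective)
import Data.Nat.Properties as ℕ
open import Data.Nat.Tactic.RingSolver using (solve-∀)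
open import Data.Product using (Σ-syntax; ∃; ∃-syntax; _×_; _,_; proj₁; proj₂)
open import Data.Sum using (_⊎_; inj₁; inj₂; [_,_]′; swap)
import Data.Sum as Sum
open import Data.Unit using (⊤; tt)
open import Data.Vec using (Vec; []; _∷_; map; replicate; tabulate; lookup)
import Data.Vec.Properties as Vec
open import Function using (_∘_; id; const)
open import Level using (0ℓ)
open import Relation.Binary using (tri<; tri≈; tri>)
open import Relation.Binary.Construct.Closure.ReflexiveTransitive
  using (Star; ε; _◅_; _◅◅_; gmap; reverse)
open import Relation.Binary.PropositionalEquality
  using (_≡_; _≢_; refl; sym; trans; cong; cong₂; subst; subst₂; module ≡-Reasoning)
open import Relation.Nullary using (Dec; yes; no; ¬_; contradiction)
open import Relation.Nullary.Decidable
  using (map′; _×-dec_; _⊎-dec_; _→-dec_; ⌊_⌋; toWitness; fromWitness)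
open import Relation.Unary using (Pred; Decidable; _⊆_; U)
open import Defs

module Σℕ = Algebra.Properties.CommutativeMonoid.Sum +-0-commutativeMonoid
open Σℕ using (sum; ∑-distrib-+; sum-cong-≗)

-- Counting

ind : Bool → ℕ
ind false = 0
ind true  = 1

ind≤1 : ∀ b → ind b ≤ 1
ind≤1 false = z≤n
ind≤1 true  = ≤-refl

ind-mono : ∀ {a b} → (T a → T b) → ind a ≤ ind b
ind-mono {false}        _ = z≤n
ind-mono {true} {true}  _ = ≤-refl
ind-mono {true} {false} f = ⊥-elim (f tt)

ind-< : {A B : Set} (a? : Dec A) (b? : Dec B) → ¬ A → B → ind ⌊ a? ⌋ < ind ⌊ b? ⌋
ind-< (yes a) _       ¬a b = contradiction a ¬a
ind-< (no _)  (yes _) ¬a b = ≤-refl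
ind-< (no _)  (no ¬b) ¬a b = contradiction b ¬b

count : ∀ {n} → (Fin n → Bool) → ℕ
count S = sum (ind ∘ S)

sum-mono-≤ : ∀ {n} {f g : Fin n → ℕ} → (∀ i → f i ≤ g i) → sum f ≤ sum g
sum-mono-≤ {zero}  f≤g = z≤n
sum-mono-≤ {suc n} f≤g = +-mono-≤ (f≤g zero) (sum-mono-≤ (f≤g ∘ suc))

sum-mono-< : ∀ {n} {f g : Fin n → ℕ} → (∀ i → f i ≤ g i) → ∀ i → f i < g i → sum f < sum g
sum-mono-< f≤g zero    f<g = +-mono-<-≤ f<g (sum-mono-≤ (f≤g ∘ suc))
sum-mono-< f≤g (suc i) f<g = +-mono-≤-< (f≤g zero) (sum-mono-< (f≤g ∘ suc) i f<g)

count≤n : ∀ {n} (S : Fin n → Bool) → count S ≤ n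
count≤n {zero}  S = z≤n
count≤n {suc n} S = +-mono-≤ (ind≤1 (S zero)) (count≤n (S ∘ suc))

nonempty : ∀ {n} (S : Fin n → Bool) → 1 ≤ count S → ∃[ x ] T (S x)
nonempty {suc n} S c with S zero in eq
... | true  = zero , subst T (sym eq) tt
... | false = let x , t = nonempty (S ∘ suc) c in suc x , t

two-distinct : ∀ {n} (S : Fin n → Bool) → 2 ≤ count S →
               ∃[ x ] ∃[ y ] x ≢ y × T (S x) × T (S y)
two-distinct {suc n} S c with S zero in eq
... | true  = let x , t = nonempty (S ∘ suc) (≤-pred c) in zero , suc x , (λ ()) , subst T (sym eq) tt , t
... | false =
  let x , y , x≢y , tx , ty = two-distinct (S ∘ suc) c
  in suc x , suc y , x≢y ∘ suc-injective , tx , ty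

count-all : ∀ n → count {n} (const true) ≡ n
count-all zero    = refl
count-all (suc n) = cong suc (count-all n)

module _ {n} (P : ℕ → Pred (Fin n) 0ℓ) (P? : ∀ r → Decidable (P r))
  (grows : ∀ r → P r ⊆ P (suc r))
  (stays : ∀ r → P (suc r) ⊆ P r → P (suc (suc r)) ⊆ P (suc r)) where

  private
    population : ℕ → ℕ
    population r = count (λ x → ⌊ P? r x ⌋)

    level-mono : ∀ r x → ind ⌊ P? r x ⌋ ≤ ind ⌊ P? (suc r) x ⌋
    level-mono r x = ind-mono (λ t → fromWitness (grows r (toWitness t)))

    fresh-or-stable : ∀ r → (P (suc r) ⊆ P r) ⊎ population r < population (suc r)
    fresh-or-stable r with any? (λ x → P? (suc r) x ×-dec (P? r x →-dec no id))
    ... | no none = inj₁ λ {x} px → stable px (P? r x)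
      where
      stable : ∀ {x} → P (suc r) x → Dec (P r x) → P r x
      stable px (yes q) = q
      stable px (no ¬q) = contradiction (_ , px , ¬q) none
    ... | yes (x , px , ¬qx) = inj₂ (sum-mono-< (level-mono r) x (ind-< (P? r x) (P? (suc r) x) ¬qx px))

    -- Until the chain first pauses, each step adds an element, so `suc r` steps without a pause
    -- give more than `r` elements.
    large-or-stable : ∀ r → (P (suc r) ⊆ P r) ⊎ r < population (suc r)
    large-or-stable zero with fresh-or-stable 0
    ... | inj₁ st = inj₁ st
    ... | inj₂ lt = inj₂ (≤-<-trans z≤n lt)
    large-or-stable (suc r) with large-or-stable r | fresh-or-stable (suc r)
    ... | inj₁ st | _       = inj₁ (stays r st)
    ... | inj₂ _  | inj₁ st = inj₁ st
    ... | inj₂ lt | inj₂ lt′ = inj₂ (≤-<-trans lt lt′)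

    stable-at-n : P (suc n) ⊆ P n
    stable-at-n with large-or-stable n
    ... | inj₁ st = st
    ... | inj₂ lt = contradiction (count≤n _) (<⇒≱ lt)

    stable-above : ∀ j → P (suc (j + n)) ⊆ P (j + n)
    stable-above zero    = stable-at-n
    stable-above (suc j) = stays (j + n) (stable-above j)

    collapse : ∀ j → P (j + n) ⊆ P n
    collapse zero    p = p
    collapse (suc j) p = collapse j (stable-above j p)

    lift : ∀ j r → P r ⊆ P (j + r)
    lift zero    r p = p
    lift (suc j) r p = grows (j + r) (lift j r p)

  -- There are only `n` elements, so the chain has paused by step `n`, and by `stays` a pause lasts
  -- forever.
  chain-stabilises : ∀ r → P r ⊆ P n
  chain-stabilises r {x} p = collapse r (subst (λ q → P q x) (+-comm n r) (lift n r p))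

any-Vec? : ∀ {n m} {P : Pred (Vec (Fin n) m) 0ℓ} → Decidable P → Dec (∃ P)
any-Vec? {m = zero}  P? = map′ (λ p → [] , p) (λ { ([] , p) → p }) (P? [])
any-Vec? {m = suc m} P? =
  map′ (λ { (i , v , p) → i ∷ v , p }) (λ { (i ∷ v , p) → i , v , p })
       (any? λ i → any-Vec? λ v → P? (i ∷ v))

fin-bound : ∀ {n} {P : Fin n → ℕ → Set} → (∀ i {a b} → a ≤ b → P i a → P i b) →
            (∀ i → ∃ (P i)) → ∃[ r ] ∀ i → P i r
fin-bound {zero}  mono f = 0 , λ ()
fin-bound {suc n} mono f with f zero | fin-bound (mono ∘ suc) (f ∘ suc)
... | a , pa | b , pb = a ⊔ b , λ where
  zero    → mono zero (m≤m⊔n a b) pa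
  (suc i) → mono (suc i) (m≤n⊔m a b) (pb i)

-- The game on sets of candidates

module Positions (k : ℕ) {G : Graph} (conn : IsConnected G) where
  open Graph G using (order; Adj; adj?; Vertex; Walk; []; walk?)
  open IsConnected conn
  open LocalizationGame k conn hiding (IsLocalizationNumber)

  move? : ∀ x y → Dec (Move x y)
  move? x y = (x ≟ y) ⊎-dec adj? x y

  response : ∀ {m} → Vec Vertex m → Vertex → Answers m
  response p x = map (probe x) p

  _≟ᴬ_ : ∀ {m} (a b : Answers m) → Dec (a ≡ b)
  _≟ᴬ_ = Vec.≡-dec (Maybe.≡-dec ℕ._≟_)

  -- The answer is represented by a vertex `y` that produces it, so that ranging over the answers
  -- that can occur means ranging over finitely many vertices.
  Next : ∀ {m} → Vec Vertex m → Vertex → Pred Vertex 0ℓ → Pred Vertex 0ℓ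
  Next p y S z = ∃[ x ] S x × response p x ≡ response p y × Move x z

  -- Win r S: knowing only that the robber is in S before the probe, the cops
  -- can locate him within r rounds.
  Win : ∀ (m : ℕ) → ℕ → Pred Vertex 0ℓ → Set
  Win m zero    S = ⊥
  Win m (suc r) S = Σ[ p ∈ Vec Vertex m ] (∀ y → S y →
    (∀ x → S x → response p x ≡ response p y → x ≡ y) ⊎ Win m r (Next p y S))

  next? : ∀ {m} (p : Vec Vertex m) y {S} → Decidable S → Decidable (Next p y S)
  next? p y S? z = any? λ x → S? x ×-dec (response p x ≟ᴬ response p y) ×-dec move? x z

  win? : ∀ m r {S} → Decidable S → Dec (Win m r S)
  win? m zero    S? = no λ ()
  win? m (suc r) S? = any-Vec? λ p → all? λ y → S? y →-dec
    (all? (λ x → S? x →-dec ((response p x ≟ᴬ response p y) →-dec (x ≟ y)))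
      ⊎-dec win? m r (next? p y S?))

  win-antitone : ∀ m r {S S′ : Pred Vertex 0ℓ} → S ⊆ S′ → Win m r S′ → Win m r S
  win-antitone m (suc r) {S} {S′} S⊆S′ (p , w) = p , λ y sy → narrow y (w y (S⊆S′ sy))
    where
    narrow : ∀ y → (∀ x → S′ x → response p x ≡ response p y → x ≡ y) ⊎ Win m r (Next p y S′) →
             (∀ x → S x → response p x ≡ response p y → x ≡ y) ⊎ Win m r (Next p y S)
    narrow y (inj₁ unique) = inj₁ λ x sx → unique x (S⊆S′ sx)
    narrow y (inj₂ w′) = inj₂ (win-antitone m r (λ { (x , sx , rest) → x , S⊆S′ sx , rest }) w′)

  win-suc : ∀ m r {S : Pred Vertex 0ℓ} → Win m r S → Win m (suc r) S
  win-suc m (suc r) {S} (p , w) = p , λ y sy → later y (w y sy)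
    where
    later : ∀ y → (∀ x → S x → response p x ≡ response p y → x ≡ y) ⊎ Win m r (Next p y S) →
            (∀ x → S x → response p x ≡ response p y → x ≡ y) ⊎ Win m (suc r) (Next p y S)
    later y (inj₁ unique) = inj₁ unique
    later y (inj₂ w′)     = inj₂ (win-suc m r w′)

  -- Finitely many positions: a bound on the number of rounds

  Code : Set
  Code = Fin (2 ^ order)

  Member : Code → Pred Vertex 0ℓ
  Member e x = finToFun {2} {order} e x ≡ 1F

  member? : ∀ e → Decidable (Member e)
  member? e x = finToFun {2} {order} e x ≟ 1F

  bit : {A : Set} → Dec A → Fin 2
  bit (yes _) = 1F
  bit (no _)  = 0F

  encode : {S : Pred Vertex 0ℓ} → Decidable S → Code
  encode S? = funToFin (λ x → bit (S? x))

  encode⁺ : {S : Pred Vertex 0ℓ} (S? : Decidable S) → S ⊆ Member (encode S?)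
  encode⁺ S? {x} sx = trans (finToFun-funToFin (λ x → bit (S? x)) x) (bit⁺ (S? x))
    where
    bit⁺ : (d : Dec _) → bit d ≡ 1F
    bit⁺ (yes _) = refl
    bit⁺ (no ¬s) = contradiction sx ¬s

  encode⁻ : {S : Pred Vertex 0ℓ} (S? : Decidable S) → Member (encode S?) ⊆ S
  encode⁻ S? {x} e = bit⁻ (S? x) (trans (sym (finToFun-funToFin (λ x → bit (S? x)) x)) e)
    where
    bit⁻ : (d : Dec _) → bit d ≡ 1F → _
    bit⁻ (yes s) _ = s

  -- Winning in `suc r` rounds is defined from winning in `r` rounds, so if one more round makes no
  -- new set winning, no later round does. Subsets are coded by the elements of `Code`, so the
  -- winning sets for each `r` form a subset of a finite type, and `chain-stabilises` bounds the
  -- number of rounds.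
  win-bound : ∀ m r {S : Pred Vertex 0ℓ} → Decidable S → Win m r S → Win m (2 ^ order) S
  win-bound m r S? w = win-antitone m _ (encode⁺ S?)
    (chain-stabilises (λ r e → Win m r (Member e)) (λ r e → win? m r (member? e))
      (λ r → win-suc m r) stays r
      (win-antitone m r (encode⁻ S?) w))
    where
    stays : ∀ r → (∀ {e} → Win m (suc r) (Member e) → Win m r (Member e)) →
            ∀ {e} → Win m (suc (suc r)) (Member e) → Win m (suc r) (Member e)
    stays r stable {e} (p , w) = p , λ y sy → earlier y (w y sy)
      where
      earlier : ∀ y → (∀ x → Member e x → response p x ≡ response p y → x ≡ y) ⊎ Win m (suc r) (Next p y (Member e)) →
                (∀ x → Member e x → response p x ≡ response p y → x ≡ y) ⊎ Win m r (Next p y (Member e))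
      earlier y (inj₁ unique) = inj₁ unique
      earlier y (inj₂ w′)     = inj₂ (win-antitone m r (encode⁺ n?)
        (stable (win-antitone m (suc r) (encode⁻ n?) w′)))
        where n? = next? p y (member? e)

  -- From strategies to winning sets

  Located : ∀ {m} → Strategy m → List (Answers m) → Vertex → Set
  Located σ h x = ∀ {y} → Candidate σ h y → x ≡ y

  -- The trajectory enters only through its answers and its last vertex, so robbers with the same
  -- answers can be compared.
  SucceedsWithin : ∀ {m} → Strategy m → ℕ → List (Answers m) → Vertex → Set
  SucceedsWithin σ zero    h x = Located σ h x
  SucceedsWithin σ (suc r) h x = Located σ h x
    ⊎ (∀ y → Move x y → SucceedsWithin σ r (response (σ h) y ∷ h) y)

  within-suc : ∀ {m} (σ : Strategy m) r {h x} →
               SucceedsWithin σ r h x → SucceedsWithin σ (suc r) h x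
  within-suc σ zero    l        = inj₁ l
  within-suc σ (suc r) (inj₁ l) = inj₁ l
  within-suc σ (suc r) (inj₂ f) = inj₂ λ y mv → within-suc σ r (f y mv)

  within-+ : ∀ {m} (σ : Strategy m) j r {h x} →
             SucceedsWithin σ r h x → SucceedsWithin σ (j + r) h x
  within-+ σ zero    r s = s
  within-+ σ (suc j) r s = within-suc σ (j + r) (within-+ σ j r s)

  within-mono : ∀ {m} (σ : Strategy m) {r r′ h x} → r ≤ r′ →
                SucceedsWithin σ r h x → SucceedsWithin σ r′ h x
  within-mono σ {r} {r′} {h} {x} r≤r′ s =
    subst (λ q → SucceedsWithin σ q h x) (m∸n+n≡m r≤r′) (within-+ σ (r′ ∸ r) r s)

  -- A form of König's lemma: the robber has finitely many moves, so the bounds for his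
  -- continuations have a maximum.
  succeeds-bounded : ∀ {m} (σ : Strategy m) {x} (τ : Trajectory x) → Succeeds σ τ →
                     ∃[ r ] SucceedsWithin σ r (answers σ τ) x
  succeeds-bounded σ {x} τ (located (y , _ , unique)) =
    0 , λ c → trans (sym (unique (τ , refl))) (unique c)
  succeeds-bounded σ {x} τ (continue next) = let r , f = fin-bound mono bounded in suc r , inj₂ f
    where
    After : Vertex → ℕ → Set
    After y r = Move x y → SucceedsWithin σ r (response (σ (answers σ τ)) y ∷ answers σ τ) y

    mono : ∀ y {a b} → a ≤ b → After y a → After y b
    mono y a≤b f mv = within-mono σ a≤b (f mv)

    bounded : ∀ y → ∃ (After y)
    bounded y with move? x y
    ... | yes mv = let r , s = succeeds-bounded σ (τ ▷ mv) (next mv) in r , λ _ → s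
    ... | no ¬mv = 0 , λ mv → contradiction mv ¬mv

  -- All vertices of `S` are candidates after the same history `h`, so the single placement `σ h`
  -- probes the whole set. Those with equal responses share a longer history, and the induction
  -- continues with them.
  succeeds⇒win : ∀ {m} (σ : Strategy m) r h (S : Pred Vertex 0ℓ) →
    (∀ x → S x → Candidate σ (response (σ h) x ∷ h) x) →
    (∀ x → S x → SucceedsWithin σ r (response (σ h) x ∷ h) x) →
    Win m (suc r) S
  succeeds⇒win {m} σ r h S cand succ = σ h , λ y sy → outcome r succ y sy (succ y sy)
    where
    same : ∀ {x y} → S x → response (σ h) x ≡ response (σ h) y →
           Candidate σ (response (σ h) y ∷ h) x
    same {x} sx eq = subst (λ a → Candidate σ (a ∷ h) x) eq (cand x sx)

    outcome : ∀ r → (∀ x → S x → SucceedsWithin σ r (response (σ h) x ∷ h) x) →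
      ∀ y → S y → SucceedsWithin σ r (response (σ h) y ∷ h) y →
      (∀ x → S x → response (σ h) x ≡ response (σ h) y → x ≡ y) ⊎ Win m r (Next (σ h) y S)
    outcome zero    _ y sy l        = inj₁ λ x sx eq → sym (l (same sx eq))
    outcome (suc r) _ y sy (inj₁ l) = inj₁ λ x sx eq → sym (l (same sx eq))
    outcome (suc r) succ y sy (inj₂ f) = inj₂ (succeeds⇒win σ r (response (σ h) y ∷ h) (Next (σ h) y S)
      (λ { z (x , sx , eq , mv) → let τ , e = same sx eq in τ ▷ mv , cong (λ h′ → response (σ h′) z ∷ h′) e })
      (λ { z (x , sx , eq , mv) → step z x sx eq mv (succ x sx) }))
      where
      step : ∀ z x → S x → response (σ h) x ≡ response (σ h) y → Move x z →
             SucceedsWithin σ (suc r) (response (σ h) x ∷ h) x →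
             SucceedsWithin σ r (response (σ (response (σ h) y ∷ h)) z ∷ response (σ h) y ∷ h) z
      step z x sx eq mv (inj₂ g) =
        subst (λ a → SucceedsWithin σ r (response (σ (a ∷ h)) z ∷ a ∷ h) z) eq (g z mv)
      -- If `x` is already located, then `y`, a candidate with the same answers, equals `x`, and the
      -- continuation `f` from `y` serves for `x`.
      step z x sx eq mv (inj₁ l) =
        f z (subst (λ v → Move v z) (l (subst (λ a → Candidate σ (a ∷ h) y) (sym eq) (cand y sy))) mv)

  copsWin⇒win : ∀ m → CopsWin m → ∃[ r ] Win m r U
  copsWin⇒win m (σ , wins) =
    let r , f = fin-bound (λ x → within-mono σ) (λ x → succeeds-bounded σ (start x) (wins x))
    in suc r , succeeds⇒win σ r [] U (λ x _ → start x , refl) (λ x _ → f x)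

  -- From winning sets to strategies

  -- What the cops know before a round: the robber has been located, or he is
  -- in a set from which they win.
  data Status (m : ℕ) : Set₁ where
    done : Status m
    todo : ∀ r {S} → Decidable S → Win m r S → Status m

  advance : ∀ {m} r {S} (S? : Decidable S) → Win m (suc r) S → Answers m → Status m
  advance r {S} S? (p , w) a with any? (λ y → S? y ×-dec (response p y ≟ᴬ a))
  ... | no _             = done
  ... | yes (y , sy , _) with w y sy
  ...   | inj₁ _  = done
  ...   | inj₂ w′ = todo r (next? p y S?) w′

  -- The search in `advance` may find some `y` other than `x` with the same response. If `y` is the
  -- only vertex of `S` with that response, then `x` equals `y`, so uniqueness carries over to `x`.
  advance-cases : ∀ {m} r {S} (S? : Decidable S) ((p , w) : Win m (suc r) S) x → S x →
    (∀ y → S y → response p y ≡ response p x → y ≡ x)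
    ⊎ (Σ[ y ∈ Vertex ] Σ[ w′ ∈ Win m r (Next p y S) ]
        advance r S? (p , w) (response p x) ≡ todo r (next? p y S?) w′)
  advance-cases r S? (p , w) x sx with any? (λ y → S? y ×-dec (response p y ≟ᴬ response p x))
  ... | no none = contradiction (x , sx , refl) none
  ... | yes (y , sy , eq) with w y sy
  ...   | inj₁ unique = inj₁ λ z sz eq′ →
          trans (unique z sz (trans eq′ (sym eq))) (sym (unique x sx (sym eq)))
  ...   | inj₂ w′ = inj₂ (y , w′ , refl)

  update : ∀ {m} → Status m → Answers m → Status m
  update (todo (suc r) S? w) a = advance r S? w a
  update done                a = done

  anywhere : Vertex
  anywhere = fromℕ< nonEmpty

  placement : ∀ {m} → Status m → Vec Vertex m
  -- A default: once the robber has been located, all cops are sent to an arbitrary vertex.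
  placement done                       = replicate _ anywhere
  placement (todo (suc r) S? (p , _)) = p

  module _ {m R} (win : Win m R U) where

    status : List (Answers m) → Status m
    status []      = todo R (λ _ → yes tt) win
    status (a ∷ h) = update (status h) a

    σ : Strategy m
    σ h = placement (status h)

    Inside : Status m → Pred Vertex 0ℓ
    Inside done               x = ⊤
    Inside (todo r {S} S? w) x = S x

    -- The invariant of the strategy: the stored set retains every vertex reachable by a robber with
    -- the observed answers, so it contains all candidates and not only the actual position.
    inside-update : ∀ s x y → Inside s x → Move x y → Inside (update s (response (placement s) x)) y
    inside-update done x y _ mv = tt
    inside-update (todo (suc r) {S} S? (p , w)) x y sx mv
      with any? (λ z → S? z ×-dec (response p z ≟ᴬ response p x))
    ... | no _ = tt
    ... | yes (z , sz , eq) with w z sz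
    ...   | inj₁ _  = tt
    ...   | inj₂ w′ = x , sx , sym eq , mv

    inside : ∀ {x} (τ : Trajectory x) {y} → Move x y → Inside (status (answers σ τ)) y
    inside (start x) {y} mv = inside-update (status []) x y tt mv
    inside (_▷_ {y = x} τ mv′) {y} mv = inside-update (status (answers σ τ)) x y (inside τ mv′) mv

    candidate-inside : ∀ {h a x} → Candidate σ (a ∷ h) x →
                       Inside (status h) x × response (σ h) x ≡ a
    candidate-inside (start x , refl) = tt , refl
    candidate-inside ((τ ▷ mv) , refl) = inside τ mv , refl

    -- Every candidate lies in the stored set and gave the same response as `x`, so uniqueness
    -- within that set is uniqueness among the candidates. Otherwise the game continues with one
    -- round fewer to go.
    succeeds : ∀ r {S} (S? : Decidable S) (w : Win m r S) h → status h ≡ todo r S? w →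
      ∀ {x} (τ : Trajectory x) → answers σ τ ≡ response (σ h) x ∷ h → Succeeds σ τ
    succeeds (suc r) {S} S? (p , w) h eq {x} τ e =
      conclude (advance-cases r S? (p , w) x (in-S (τ , e)))
      where
      σh≡p : σ h ≡ p
      σh≡p = cong placement eq

      in-S : ∀ {a y} → Candidate σ (a ∷ h) y → S y
      in-S {y = y} c = subst (λ s → Inside s y) eq (proj₁ (candidate-inside c))

      same : ∀ {y} → Candidate σ (answers σ τ) y → response p y ≡ response p x
      same {y} (τ′ , e′) = subst (λ q → response q y ≡ response q x) σh≡p
        (proj₂ (candidate-inside (τ′ , trans e′ e)))

      conclude : _ → Succeeds σ τ
      conclude (inj₁ unique) = located (x , (τ , refl) , λ {y} c →
        sym (unique y (in-S (proj₁ c , trans (proj₂ c) e)) (same c)))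
      conclude (inj₂ (y , w′ , eq′)) = continue λ {z} mv →
        succeeds r (next? p y S?) w′ (response (σ h) x ∷ h)
          (trans (cong₂ (λ s q → update s (response q x)) eq σh≡p) eq′)
          (τ ▷ mv) (cong (λ h′ → response (σ h′) z ∷ h′) e)

  win⇒copsWin : ∀ m r → Win m r U → CopsWin m
  win⇒copsWin m r w = σ w , λ x → succeeds w r (λ _ → yes tt) w [] refl (start x) refl

  copsWin? : ∀ m → Dec (CopsWin m)
  copsWin? m = map′ (win⇒copsWin m (2 ^ order))
    (λ c → let r , w = copsWin⇒win m c in win-bound m r (λ _ → yes tt) w)
    (win? m (2 ^ order) (λ _ → yes tt))

  -- Distances and the existence of the localization number

  dist-walk : ∀ u v → Walk (dist u v) u v
  dist-walk u v = let r , p = connected u v in proj₁ (proj₂ (least (walk? u v) r p))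

  dist-refl : ∀ x → dist x x ≡ 0
  dist-refl x = let r , p = connected x x in n≤0⇒n≡0 (proj₂ (proj₂ (least (walk? x x) r p)) [])

  dist≡0⇒≡ : ∀ {u v} → dist u v ≡ 0 → u ≡ v
  dist≡0⇒≡ {u} {v} eq with subst (λ r → Walk r u v) eq (dist-walk u v)
  ... | [] = refl

  probe-self : ∀ x → probe x x ≡ just 0
  probe-self x with dist x x ≤? k
  ... | yes _ = cong just (dist-refl x)
  ... | no ≰k = contradiction (subst (_≤ k) (sym (dist-refl x)) z≤n) ≰k

  probe≡0⇒≡ : ∀ {x u} → probe x u ≡ just 0 → u ≡ x
  probe≡0⇒≡ {x} {u} eq with dist u x ≤? k
  ... | yes _ = dist≡0⇒≡ (Maybe.just-injective eq)

  -- With a cop on every vertex, the answer `just 0` comes from the robber's own vertex alone,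
  -- whatever `k` is.
  order-many-win : CopsWin order
  order-many-win = win⇒copsWin order 1 (tabulate id , λ y _ → inj₁ λ x _ eq →
    sym (probe≡0⇒≡ (trans (trans (sym (at x y)) (cong (λ v → lookup v y) eq)) (trans (at y y) (probe-self y)))))
    where
    at : ∀ x y → lookup (response (tabulate id) x) y ≡ probe x y
    at x y = trans (Vec.lookup-map y (probe x) (tabulate id)) (cong (probe x) (Vec.lookup∘tabulate id y))

  localizationNumber : ∃ (IsLocalizationNumber k conn)
  localizationNumber =
    least (λ m → (1 ≤? m) ×-dec copsWin? m) order (nonEmpty , order-many-win)

  -- Evasion by staying out of sight

  module Evasion (C s D : ℕ)
    (ball-small : ∀ u (S : Vertex → Bool) → (∀ x → T (S x) → dist u x ≤ k) → count S ≤ C)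
    (expands : ∀ (S S′ : Vertex → Bool) → (∀ x y → T (S x) → Move x y → T (S′ y)) →
               s ≤ count S → s + D ≤ count S′)
    (2≤s : 2 ≤ s) where

    unseen : Vertex → Vertex → Bool
    unseen u x = ⌊ Maybe.≡-dec ℕ._≟_ (probe x u) nothing ⌋

    survivors : ∀ {m} → Vec Vertex m → (Vertex → Bool) → Vertex → Bool
    survivors []      S = S
    survivors (u ∷ p) S = survivors p (λ x → S x ∧ unseen u x)

    survivors-response : ∀ {m} (p : Vec Vertex m) S x → T (survivors p S x) →
                         T (S x) × response p x ≡ replicate m nothing
    survivors-response []      S x t = t , refl
    survivors-response (u ∷ p) S x t =
      let t′ , eq = survivors-response p _ x t
          sx , ux = T-∧⁻ (S x) t′
      in sx , cong₂ _∷_ (toWitness {a? = Maybe.≡-dec ℕ._≟_ (probe x u) nothing} ux) eq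
      where
      T-∧⁻ : ∀ a {b} → T (a ∧ b) → T a × T b
      T-∧⁻ true t = tt , t

    seen-near : ∀ u x → T (not (unseen u x)) → dist u x ≤ k
    seen-near u x t with dist u x ≤? k
    ... | yes near = near

    -- Each cop rules out only vertices in its own ball of radius `k`, at most `C` of them.
    survivors-count : ∀ {m} (p : Vec Vertex m) S → count S ≤ count (survivors p S) + m * C
    survivors-count []      S = m≤m+n _ 0
    survivors-count {suc m} (u ∷ p) S = begin
      count S ≤⟨ sum-mono-≤ (λ x → ind-split (S x) (unseen u x)) ⟩
      sum (λ x → ind (S x ∧ unseen u x) + ind (not (unseen u x)))
        ≡⟨ ∑-distrib-+ (λ x → ind (S x ∧ unseen u x)) (λ x → ind (not (unseen u x))) ⟩
      count (λ x → S x ∧ unseen u x) + count (not ∘ unseen u)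
        ≤⟨ +-mono-≤ (survivors-count p _) (ball-small u _ (seen-near u)) ⟩
      (count (survivors (u ∷ p) S) + m * C) + C ≡⟨ +-assoc _ (m * C) C ⟩
      count (survivors (u ∷ p) S) + (m * C + C) ≡⟨ cong (count (survivors (u ∷ p) S) +_) (+-comm (m * C) C) ⟩
      count (survivors (u ∷ p) S) + suc m * C ∎
      where
      open ≤-Reasoning
      ind-split : ∀ a b → ind a ≤ ind (a ∧ b) + ind (not b)
      ind-split false b     = z≤n
      ind-split true  false = ≤-refl
      ind-split true  true  = ≤-refl

    -- The robber maintains `s + D` candidates before each probe. When all cops see nothing, at
    -- least `s` of them remain; as `2 ≤ s`, none is located, and `expands` restores `s + D` after
    -- the move.
    evades : ∀ {m} → m * C ≤ D → ∀ r (S : Vertex → Bool) → s + D ≤ count S → ¬ Win m r (T ∘ S)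
    evades {m} mC≤D (suc r) S large (p , w) = absurd (two-distinct S₁ (≤-trans 2≤s large₁))
      where
      S₁ : Vertex → Bool
      S₁ = survivors p S

      large₁ : s ≤ count S₁
      large₁ = +-cancelʳ-≤ D s (count S₁)
        (≤-trans large (≤-trans (survivors-count p S) (+-monoʳ-≤ (count S₁) mC≤D)))

      near? : ∀ z → Dec (∃[ x ] T (S₁ x) × Move x z)
      near? z = any? λ x → T? (S₁ x) ×-dec move? x z

      S₂ : Vertex → Bool
      S₂ z = ⌊ near? z ⌋

      large₂ : s + D ≤ count S₂
      large₂ = expands S₁ S₂ (λ x y t mv → fromWitness (x , t , mv)) large₁

      same : ∀ {x y} → T (S₁ x) → T (S₁ y) → response p x ≡ response p y
      same tx ty = trans (proj₂ (survivors-response p S _ tx)) (sym (proj₂ (survivors-response p S _ ty)))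

      absurd : ¬ (Σ[ x ∈ Vertex ] Σ[ y ∈ Vertex ] x ≢ y × T (S₁ x) × T (S₁ y))
      absurd (x , y , x≢y , tx , ty) with w y (proj₁ (survivors-response p S y ty))
      ... | inj₁ unique = x≢y (unique x (proj₁ (survivors-response p S x tx)) (same tx ty))
      ... | inj₂ w′ = evades mC≤D r S₂ large₂ (win-antitone m r
        (λ {z} t → let x′ , tx′ , mv = toWitness {a? = near? z} t in
          x′ , proj₁ (survivors-response p S x′ tx′) , same tx′ ty , mv) w′)

    cops-lose : ∀ {m} → m * C ≤ D → s ≤ order → ¬ CopsWin m
    cops-lose {m} mC≤D s≤order c =
      let r , w = copsWin⇒win m c
      -- Expansion applied to the whole vertex set yields the initial bound `s + D ≤ order`.
      in evades mC≤D r (const true) (expands (const true) (const true) _ (subst (s ≤_) (sym (count-all order)) s≤order))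
           (win-antitone m r (λ _ → tt) w)

-- Complete binary trees

-- A node is its path from the root, so a set restricts to the two subtrees by composition with
-- `left` and `right`, and inductions follow the tree.
data Node : ℕ → Set where
  root       : ∀ {h} → Node h
  left right : ∀ {h} → Node h → Node (suc h)

size : ℕ → ℕ
size zero    = 1
size (suc h) = suc (size h + size h)

index : ∀ {h} → Node h → Fin (size h)
index {zero}  root      = zero
index {suc h} root      = zero
index {suc h} (left x)  = suc (index x ↑ˡ size h)
index {suc h} (right x) = suc (size h ↑ʳ index x)

node : ∀ {h} → Fin (size h) → Node h
node {zero}  _       = root
node {suc h} zero    = root
node {suc h} (suc i) = [ left ∘ node , right ∘ node ]′ (splitAt (size h) i)

node-index : ∀ {h} (x : Node h) → node (index x) ≡ x
node-index {zero}  root      = refl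
node-index {suc h} root      = refl
node-index {suc h} (left x)  rewrite splitAt-↑ˡ (size h) (index x) (size h) = cong left (node-index x)
node-index {suc h} (right x) rewrite splitAt-↑ʳ (size h) (size h) (index x) = cong right (node-index x)

index-node : ∀ {h} (i : Fin (size h)) → index (node {h} i) ≡ i
index-node {zero}  zero    = refl
index-node {suc h} zero    = refl
index-node {suc h} (suc i) with splitAt (size h) i in eq
... | inj₁ j = cong suc (trans (cong (_↑ˡ size h) (index-node {h} j)) (splitAt⁻¹-↑ˡ eq))
... | inj₂ j = cong suc (trans (cong (size h ↑ʳ_) (index-node {h} j)) (splitAt⁻¹-↑ʳ eq))

node-injective : ∀ {h} {i j : Fin (size h)} → node {h} i ≡ node j → i ≡ j
node-injective {h} {i} {j} eq = trans (sym (index-node {h} i)) (trans (cong index eq) (index-node {h} j))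

data Child : ∀ {h} → Node h → Node h → Set where
  toLeft  : ∀ {h} → Child {suc h} root (left root)
  toRight : ∀ {h} → Child {suc h} root (right root)
  inLeft  : ∀ {h} {x y : Node h} → Child x y → Child (left x) (left y)
  inRight : ∀ {h} {x y : Node h} → Child x y → Child (right x) (right y)

child? : ∀ {h} (x y : Node h) → Dec (Child x y)
child? root      root             = no λ ()
child? root      (left root)      = yes toLeft
child? root      (left (left _))  = no λ ()
child? root      (left (right _)) = no λ ()
child? root      (right root)     = yes toRight
child? root      (right (left _)) = no λ ()
child? root      (right (right _)) = no λ ()
child? (left x)  root             = no λ ()
child? (left x)  (left y)         = map′ inLeft (λ { (inLeft c) → c }) (child? x y)
child? (left x)  (right y)        = no λ ()
child? (right x) root             = no λ ()
child? (right x) (left y)         = no λ ()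
child? (right x) (right y)        = map′ inRight (λ { (inRight c) → c }) (child? x y)

depth : ∀ {h} → Node h → ℕ
depth root      = 0
depth (left x)  = suc (depth x)
depth (right x) = suc (depth x)

child-depth : ∀ {h} {x y : Node h} → Child x y → depth y ≡ suc (depth x)
child-depth toLeft      = refl
child-depth toRight     = refl
child-depth (inLeft c)  = cong suc (child-depth c)
child-depth (inRight c) = cong suc (child-depth c)

-- A missing parent or child is replaced by the node itself.
up downˡ downʳ : ∀ {h} → Node h → Node h
up root                = root
up (left root)         = root
up (left x@(left _))   = left (up x)
up (left x@(right _))  = left (up x)
up (right root)        = root
up (right x@(left _))  = right (up x)
up (right x@(right _)) = right (up x)
downˡ {zero}  root      = root
downˡ {suc h} root      = left root
downˡ         (left x)  = left (downˡ x)
downˡ         (right x) = right (downˡ x)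
downʳ {zero}  root      = root
downʳ {suc h} root      = right root
downʳ         (left x)  = left (downʳ x)
downʳ         (right x) = right (downʳ x)

child-up : ∀ {h} {x y : Node h} → Child x y → x ≡ up y
child-up toLeft      = refl
child-up toRight     = refl
child-up (inLeft {y = left _} c)   = cong left (child-up c)
child-up (inLeft {y = right _} c)  = cong left (child-up c)
child-up (inRight {y = left _} c)  = cong right (child-up c)
child-up (inRight {y = right _} c) = cong right (child-up c)

child-down : ∀ {h} {x y : Node h} → Child x y → y ≡ downˡ x ⊎ y ≡ downʳ x
child-down toLeft      = inj₁ refl
child-down toRight     = inj₂ refl
child-down (inLeft c)  = Sum.map (cong left) (cong left) (child-down c)
child-down (inRight c) = Sum.map (cong right) (cong right) (child-down c)

Link : ∀ {h} → Node h → Node h → Set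
Link x y = Child x y ⊎ Child y x

binaryTree : ℕ → Graph
binaryTree h = record
  { order  = size h
  ; Adj    = λ i j → Link (node {h} i) (node j)
  ; adj?   = λ i j → child? (node {h} i) (node j) ⊎-dec child? (node j) (node i)
  ; sym    = swap
  ; irrefl = λ { refl → [ loopless , loopless ]′ }
  }
  where
  loopless : ∀ {x : Node h} → ¬ Child x x
  loopless c = 1+n≢n (sym (child-depth c))

root-path : ∀ {h} (x : Node h) → Star Link root x
root-path root      = ε
root-path (left x)  = inj₁ toLeft ◅ gmap left (Sum.map inLeft inLeft) (root-path x)
root-path (right x) = inj₁ toRight ◅ gmap right (Sum.map inRight inRight) (root-path x)

binaryTree-connected : ∀ h → IsConnected (binaryTree h)
binaryTree-connected h = record
  { nonEmpty  = size-positive h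
  ; connected = λ u v →
      let r , w = walk (reverse swap (root-path (node {h} u)) ◅◅ root-path (node {h} v))
      in r , subst₂ (Walk r) (index-node {h} u) (index-node {h} v) w
  }
  where
  open Graph (binaryTree h) using (Walk; []; _∷_)
  size-positive : ∀ h → 0 < size h
  size-positive zero    = ≤-refl
  size-positive (suc h) = s≤s z≤n

  walk : ∀ {x y : Node h} → Star Link x y → ∃[ r ] Walk r (index x) (index y)
  walk ε = 0 , []
  walk (_◅_ {x} {y} a s) =
    let r , w = walk s
    in suc r , subst₂ Link (sym (node-index x)) (sym (node-index y)) a ∷ w

argmax : ∀ {n} (f : Fin (suc n) → ℕ) → ∃[ i ] ∀ j → f j ≤ f i
argmax {zero}  f = zero , λ { zero → ≤-refl }
argmax {suc n} f with argmax (f ∘ suc)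
... | i , top with ≤-total (f zero) (f (suc i))
...   | inj₁ le = suc i , λ { zero → le ; (suc j) → top j }
...   | inj₂ ge = zero , λ { zero → ≤-refl ; (suc j) → ≤-trans (top j) ge }

module _ {G : Graph} (c : Cycle G) where
  open Graph G using (Adj)
  open Cycle c

  cycle-neighbours : ∀ i → ∃[ a ] ∃[ b ] a ≢ b × Adj (vertices i) (vertices a) × Adj (vertices i) (vertices b)
  cycle-neighbours zero = suc zero , fromℕ _ , (λ ()) , steps zero , Graph.sym G closes
  cycle-neighbours (suc j) with view j
  ... | ‵fromℕ = inject₁ (fromℕ _) , zero , (λ ()) , Graph.sym G (steps (fromℕ _)) , closes
  ... | ‵inject₁ i = inject₁ (inject₁ i) , suc (suc i) , apart , Graph.sym G (steps (inject₁ i)) , steps (suc i)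
    where
    apart : inject₁ (inject₁ i) ≢ suc (suc i)
    apart eq = <⇒≢ (m<n⇒m<1+n ≤-refl) (trans
      (sym (trans (toℕ-inject₁ (inject₁ i)) (toℕ-inject₁ i))) (cong toℕ eq))

-- At a deepest vertex of a cycle both neighbours would be the parent.
binaryTree-acyclic : ∀ h → ¬ Cycle (binaryTree h)
binaryTree-acyclic h c =
  let i , top = argmax (λ j → depth (at j))
      a , b , a≢b , ia , ib = cycle-neighbours c i
  in a≢b (distinct (node-injective {h} (trans (child-up (parent i top ia)) (sym (child-up (parent i top ib))))))
  where
  open Cycle c
  at : Fin _ → Node h
  at j = node (vertices j)

  parent : ∀ i {a} → (∀ j → depth (at j) ≤ depth (at i)) → Link (at i) (at a) → Child (at a) (at i)
  parent i     top (inj₂ c) = c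
  parent i {a} top (inj₁ c) = contradiction (subst (_≤ depth (at i)) (child-depth c) (top a)) 1+n≰n

binaryTree-isTree : ∀ h → IsTree (binaryTree h)
binaryTree-isTree h = record { isConnected = binaryTree-connected h ; acyclic = binaryTree-acyclic h }


-- The size of balls

neighbours : ∀ {h} → Node h → List (Node h)
neighbours x = up x ∷ downˡ x ∷ downʳ x ∷ []

link⇒neighbour : ∀ {h} {x y : Node h} → Link x y → y ∈ neighbours x
link⇒neighbour (inj₂ c) = here (child-up c)
link⇒neighbour (inj₁ c) with child-down c
... | inj₁ eq = there (here eq)
... | inj₂ eq = there (there (here eq))

-- A crude bound from at most three neighbours per node; what matters is that it does not depend on
-- the height.
ballBound : ℕ → ℕ
ballBound zero    = 1
ballBound (suc k) = suc (3 * ballBound k)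

ball : ∀ {h} → ℕ → Node h → List (Node h)
ball zero    x = x ∷ []
ball (suc k) x = x ∷ concatMap (ball k) (neighbours x)

length-concatMap-≤ : ∀ {A B : Set} (f : A → List B) {b} → (∀ x → length (f x) ≤ b) →
                     ∀ xs → length (concatMap f xs) ≤ length xs * b
length-concatMap-≤ f f≤b []       = z≤n
length-concatMap-≤ f f≤b (x ∷ xs) = ≤-trans (≤-reflexive (List.length-++ (f x)))
  (+-mono-≤ (f≤b x) (length-concatMap-≤ f f≤b xs))

length-ball : ∀ {h} k (x : Node h) → length (ball k x) ≤ ballBound k
length-ball zero    x = ≤-refl
length-ball (suc k) x = s≤s (length-concatMap-≤ (ball k) (length-ball k) (neighbours x))

walk∈ball : ∀ {h r k i j} → r ≤ k → Graph.Walk (binaryTree h) r i j → node {h} j ∈ ball k (node i)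
walk∈ball {k = zero}  _         Graph.[]      = here refl
walk∈ball {k = suc k} _         Graph.[]      = here refl
walk∈ball {h} {k = suc k} {i} (s≤s r≤k) (a Graph.∷ w) =
  there (∈-concatMap⁺ (ball k) (Any.map (λ { refl → walk∈ball {h} r≤k w }) (link⇒neighbour a)))

count-singleton : ∀ {n} (x : Fin n) → sum (λ y → ind ⌊ x ≟ y ⌋) ≤ 1
count-singleton {suc n} zero    = ≤-reflexive (cong suc (Σℕ.sum-replicate-zero n))
count-singleton {suc n} (suc x) = subst (_≤ 1) (sum-cong-≗ (λ y → same (x ≟ y))) (count-singleton x)
  where
  same : ∀ {y} (d : Dec (x ≡ y)) → ind ⌊ d ⌋ ≡ ind ⌊ map′ (cong suc) suc-injective d ⌋
  same (yes _) = refl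
  same (no _)  = refl

-- Double counting: every element of `S` is hit at least once by the list, possibly with
-- repetitions, and each entry hits at most one vertex.
count-list : ∀ {n} (S : Fin n → Bool) (xs : List (Fin n)) → (∀ x → T (S x) → x ∈ xs) → count S ≤ length xs
count-list {n} S xs cover = ≤-trans (sum-mono-≤ (λ x → pointwise x (S x) (cover x))) (bound xs)
  where
  hits : List (Fin n) → Fin n → ℕ
  hits []       x = 0
  hits (y ∷ ys) x = ind ⌊ y ≟ x ⌋ + hits ys x

  hit : ∀ {x ys} → x ∈ ys → 1 ≤ hits ys x
  hit {x} {y ∷ ys} (here eq) with y ≟ x
  ... | yes _  = s≤s z≤n
  ... | no y≢x = contradiction (sym eq) y≢x
  hit {x} {y ∷ ys} (there x∈ys) = ≤-trans (hit x∈ys) (m≤n+m _ (ind ⌊ y ≟ x ⌋))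

  pointwise : ∀ x b → (T b → x ∈ xs) → ind b ≤ hits xs x
  pointwise x false _ = z≤n
  pointwise x true  f = hit (f tt)

  bound : ∀ ys → sum (hits ys) ≤ length ys
  bound []       = ≤-reflexive (Σℕ.sum-replicate-zero n)
  bound (y ∷ ys) = ≤-trans (≤-reflexive (∑-distrib-+ (λ x → ind ⌊ y ≟ x ⌋) (hits ys)))
    (+-mono-≤ (count-singleton y) (bound ys))

ball-count : ∀ {h} k (conn : IsConnected (binaryTree h)) u (S : Fin (size h) → Bool) →
             (∀ x → T (S x) → IsConnected.dist conn u x ≤ k) → count S ≤ ballBound k
ball-count {h} k conn u S near = ≤-trans
  (count-list S (List.map index (ball k (node {h} u))) (λ x t →
    subst (_∈ _) (index-node {h} x)
      (∈-map⁺ index (walk∈ball {h} (near x t) (Positions.dist-walk k conn u x)))))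
  (≤-trans (≤-reflexive (List.length-map index (ball k (node {h} u)))) (length-ball k (node {h} u)))

-- Sums over the nodes by recursion on the tree

total : ∀ {h} → (Node h → ℕ) → ℕ
total {zero}  f = f root
total {suc h} f = f root + (total (f ∘ left) + total (f ∘ right))

sum-++ : ∀ m {n} (f : Fin (m + n) → ℕ) → sum f ≡ sum (f ∘ (_↑ˡ n)) + sum (f ∘ (m ↑ʳ_))
sum-++ zero    f = refl
sum-++ (suc m) f = trans (cong (f zero +_) (sum-++ m (f ∘ suc))) (sym (+-assoc (f zero) _ _))

sum-node : ∀ {h} (f : Node h → ℕ) → sum (f ∘ node {h}) ≡ total f
sum-node {zero}  f = +-identityʳ (f root)
sum-node {suc h} f = cong (f root +_) (trans (sum-++ (size h) (f ∘ node {suc h} ∘ suc))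
  (cong₂ _+_
    (trans (sum-cong-≗ (λ i → cong (λ s → f ([ left ∘ node , right ∘ node ]′ s)) (splitAt-↑ˡ (size h) i (size h))))
           (sum-node (f ∘ left)))
    (trans (sum-cong-≗ (λ i → cong (λ s → f ([ left ∘ node , right ∘ node ]′ s)) (splitAt-↑ʳ (size h) (size h) i)))
           (sum-node (f ∘ right)))))

-- Isoperimetry

weight : ∀ {h} → (Node h → Bool) → ℕ
weight c = total (ind ∘ c)

weight≤size : ∀ {h} (c : Node h → Bool) → weight c ≤ size h
weight≤size {zero}  c = ind≤1 (c root)
weight≤size {suc h} c = +-mono-≤ (ind≤1 (c root)) (+-mono-≤ (weight≤size (c ∘ left)) (weight≤size (c ∘ right)))

weight-mono : ∀ {h} (S U : Node h → Bool) → (∀ x → T (S x) → T (U x)) → weight S ≤ weight U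
weight-mono {zero}  S U S⊆U = ind-mono (S⊆U root)
weight-mono {suc h} S U S⊆U = +-mono-≤ (ind-mono (S⊆U root))
  (+-mono-≤ (weight-mono _ _ (S⊆U ∘ left)) (weight-mono _ _ (S⊆U ∘ right)))

-- level d c is the number of bichromatic edges whose lower endpoint has depth d + 1.
level : ∀ {h} → ℕ → (Node h → Bool) → ℕ
level {zero}  d       c = 0
level {suc h} zero    c = ind (c root xor c (left root)) + ind (c root xor c (right root))
level {suc h} (suc d) c = level d (c ∘ left) + level d (c ∘ right)

-- The size of the edge boundary of the set `c`.
cuts : ∀ {h} → (Node h → Bool) → ℕ
cuts {zero}  c = 0
cuts {suc h} c = level 0 c + (cuts (c ∘ left) + cuts (c ∘ right))

-- The summand for the root is the slack that pays for the edge above it.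
cuts-boundary : ∀ {h} (S U : Node h → Bool) → (∀ x → T (S x) → T (U x)) →
  (∀ x y → Child x y → T (S x) → T (U y)) → (∀ x y → Child x y → T (S y) → T (U x)) →
  (cuts S + 3 * weight S) + ind (U root ∧ not (S root)) ≤ 3 * weight U
cuts-boundary {zero} S U S⊆U _ _ = leaf (S root) (U root) (S⊆U root)
  where
  leaf : ∀ s u → (T s → T u) → 3 * ind s + ind (u ∧ not s) ≤ 3 * ind u
  leaf false false _ = z≤n
  leaf false true  _ = s≤s z≤n
  leaf true  true  _ = ≤-refl
  leaf true  false f = ⊥-elim (f tt)
cuts-boundary {suc h} S U S⊆U down up = begin
  (level 0 S + (cuts S₁ + cuts S₂) + 3 * (ind s + (weight S₁ + weight S₂))) + ind (u ∧ not s)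
    ≡⟨ collect (level 0 S) (cuts S₁) (cuts S₂) (ind s) (weight S₁) (weight S₂) (ind (u ∧ not s)) ⟩
  (level 0 S + 3 * ind s + ind (u ∧ not s)) + ((cuts S₁ + 3 * weight S₁) + (cuts S₂ + 3 * weight S₂))
    ≤⟨ +-monoˡ-≤ _ (top s u (S (left root)) (U (left root)) (S (right root)) (U (right root))
         (S⊆U root) (down _ _ toLeft) (up _ _ toLeft) (down _ _ toRight) (up _ _ toRight)) ⟩
  (3 * ind u + slack₁ + slack₂) + ((cuts S₁ + 3 * weight S₁) + (cuts S₂ + 3 * weight S₂))
    ≡⟨ regroup (3 * ind u) slack₁ slack₂ (cuts S₁ + 3 * weight S₁) (cuts S₂ + 3 * weight S₂) ⟩
  3 * ind u + (((cuts S₁ + 3 * weight S₁) + slack₁) + ((cuts S₂ + 3 * weight S₂) + slack₂))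
    ≤⟨ +-monoʳ-≤ (3 * ind u) (+-mono-≤
         (cuts-boundary S₁ U₁ (S⊆U ∘ left) (λ x y e → down _ _ (inLeft e)) (λ x y e → up _ _ (inLeft e)))
         (cuts-boundary S₂ U₂ (S⊆U ∘ right) (λ x y e → down _ _ (inRight e)) (λ x y e → up _ _ (inRight e)))) ⟩
  3 * ind u + (3 * weight U₁ + 3 * weight U₂)
    ≡⟨ factor (ind u) (weight U₁) (weight U₂) ⟩
  3 * (ind u + (weight U₁ + weight U₂)) ∎
  where
  open ≤-Reasoning
  s = S root
  u = U root
  S₁ = S ∘ left
  S₂ = S ∘ right
  U₁ = U ∘ left
  U₂ = U ∘ right
  slack₁ = ind (U₁ root ∧ not (S₁ root))
  slack₂ = ind (U₂ root ∧ not (S₂ root))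

  collect : ∀ l a b i p q j → (l + (a + b) + 3 * (i + (p + q))) + j
            ≡ (l + 3 * i + j) + ((a + 3 * p) + (b + 3 * q))
  collect = solve-∀

  regroup : ∀ i a b x y → (i + a + b) + (x + y) ≡ i + ((x + a) + (y + b))
  regroup = solve-∀

  factor : ∀ i a b → 3 * i + (3 * a + 3 * b) ≡ 3 * (i + (a + b))
  factor = solve-∀

  -- A bichromatic edge is paid for by its endpoint outside `S`. If the root is in `S`, this is a
  -- child, whose slack is used. If the root is in `U` but not in `S`, its contribution of 3 pays
  -- for at most two child edges and leaves one unit for the edge above.
  top : ∀ s u l l′ r r′ → (T s → T u) → (T s → T l′) → (T l → T u) → (T s → T r′) → (T r → T u) →
        ind (s xor l) + ind (s xor r) + 3 * ind s + ind (u ∧ not s)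
        ≤ 3 * ind u + ind (l′ ∧ not l) + ind (r′ ∧ not r)
  top true  false l l′ r r′ su _ _ _ _ = ⊥-elim (su tt)
  top true  true  l false r r′ _ sl _ _ _ = ⊥-elim (sl tt)
  top true  true  l true r false _ _ _ sr _ = ⊥-elim (sr tt)
  top true  true  false true false true _ _ _ _ _ = ≤-refl
  top true  true  false true true  true _ _ _ _ _ = ≤-refl
  top true  true  true  true false true _ _ _ _ _ = ≤-refl
  top true  true  true  true true  true _ _ _ _ _ = ≤-refl
  top false false true  l′ r r′ _ _ lu _ _ = ⊥-elim (lu tt)
  top false false false l′ true r′ _ _ _ _ ru = ⊥-elim (ru tt)
  top false false false l′ false r′ _ _ _ _ _ = z≤n
  top false true  l l′ r r′ _ _ _ _ _ = begin
    ind l + ind r + 0 + 1 ≤⟨ +-monoˡ-≤ 1 (+-monoˡ-≤ 0 (+-mono-≤ (ind≤1 l) (ind≤1 r))) ⟩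
    3                     ≤⟨ ≤-trans (m≤m+n 3 (ind (l′ ∧ not l))) (m≤m+n _ _) ⟩
    3 + ind (l′ ∧ not l) + ind (r′ ∧ not r) ∎

-- Nearly monochromatic subtrees

differ : ∀ {h} → Bool → (Node h → Bool) → ℕ
differ b c = weight (λ x → b xor c x)

-- If the reference colour differs from that of the root, the whole subtree is counted as error.
differ-step : ∀ {h} b (c : Node h → Bool) →
              differ b c ≤ ind (b xor c root) * size h + differ (c root) c
differ-step b c with c root in eq
differ-step {h} false c | false = ≤-refl
differ-step {h} true  c | true  = ≤-refl
differ-step {h} false c | true  = ≤-trans (≤-trans (weight≤size _) (m≤m+n (size h) 0)) (m≤m+n _ _)
differ-step {h} true  c | false = ≤-trans (≤-trans (weight≤size _) (m≤m+n (size h) 0)) (m≤m+n _ _)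

differ-branch : ∀ {h} (c : Node (suc h) → Bool) → differ (c root) c ≤
  (ind (c root xor c (left root)) * size h + differ (c (left root)) (c ∘ left))
  + (ind (c root xor c (right root)) * size h + differ (c (right root)) (c ∘ right))
differ-branch c rewrite xor-same (c root) =
  +-mono-≤ (differ-step (c root) (c ∘ left)) (differ-step (c root) (c ∘ right))

size-mono-suc : ∀ h → size h ≤ size (suc h)
size-mono-suc h = m≤n⇒m≤1+n (m≤m+n (size h) (size h))

-- A node coloured unlike the root lies below some bichromatic edge, and at most `size h` nodes lie
-- below any one edge.
differ≤cuts : ∀ {h} (c : Node h → Bool) → differ (c root) c ≤ cuts c * size h
differ≤cuts {zero}  c = ≤-reflexive (cong ind (xor-same (c root)))
differ≤cuts {suc h} c = begin
  differ (c root) c ≤⟨ differ-branch c ⟩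
  (x * size h + differ (c (left root)) (c ∘ left)) + (y * size h + differ (c (right root)) (c ∘ right))
    ≤⟨ +-mono-≤ (+-monoʳ-≤ (x * size h) (differ≤cuts (c ∘ left)))
                (+-monoʳ-≤ (y * size h) (differ≤cuts (c ∘ right))) ⟩
  (x * size h + cuts (c ∘ left) * size h) + (y * size h + cuts (c ∘ right) * size h)
    ≡⟨ collect x y (cuts (c ∘ left)) (cuts (c ∘ right)) (size h) ⟩
  cuts c * size h ≤⟨ *-monoʳ-≤ (cuts c) (size-mono-suc h) ⟩
  cuts c * size (suc h) ∎
  where
  open ≤-Reasoning
  x = ind (c root xor c (left root))
  y = ind (c root xor c (right root))
  collect : ∀ x y a b n → (x * n + a * n) + (y * n + b * n) ≡ ((x + y) + (a + b)) * n
  collect = solve-∀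

-- With no bichromatic edge in the top g levels, only subtrees at depth g that
-- contain a bichromatic edge can differ from the root.
differ-banded : ∀ g {a} (c : Node (g + a) → Bool) → (∀ i → i < g → level i c ≡ 0) →
                differ (c root) c ≤ cuts c * size a
differ-banded zero    c _ = differ≤cuts c
differ-banded (suc g) {a} c quiet = begin
  differ (c root) c ≤⟨ differ-branch c ⟩
  (x * n + differ (c (left root)) (c ∘ left)) + (y * n + differ (c (right root)) (c ∘ right))
    ≡⟨ cong₂ (λ x y → (x * n + differ (c (left root)) (c ∘ left)) + (y * n + differ (c (right root)) (c ∘ right)))
         (m+n≡0⇒m≡0 x (quiet 0 (s≤s z≤n))) (m+n≡0⇒n≡0 x (quiet 0 (s≤s z≤n))) ⟩
  differ (c (left root)) (c ∘ left) + differ (c (right root)) (c ∘ right)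
    ≤⟨ +-mono-≤
         (differ-banded g (c ∘ left) λ i i<g → m+n≡0⇒m≡0 _ (quiet (suc i) (s≤s i<g)))
         (differ-banded g (c ∘ right) λ i i<g → m+n≡0⇒n≡0 (level i (c ∘ left)) (quiet (suc i) (s≤s i<g))) ⟩
  cuts (c ∘ left) * size a + cuts (c ∘ right) * size a
    ≡⟨ *-distribʳ-+ (size a) (cuts (c ∘ left)) (cuts (c ∘ right)) ⟨
  (cuts (c ∘ left) + cuts (c ∘ right)) * size a
    ≤⟨ *-monoˡ-≤ (size a) (m≤n+m _ (level 0 c)) ⟩
  cuts c * size a ∎
  where
  open ≤-Reasoning
  n = size (g + a)
  x = ind (c root xor c (left root))
  y = ind (c root xor c (right root))

ind-not : ∀ b → ind b + ind (not b) ≡ 1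
ind-not false = refl
ind-not true  = refl

weight-complement : ∀ {h} (c : Node h → Bool) → weight c + differ true c ≡ size h
weight-complement {zero}  c = ind-not (c root)
weight-complement {suc h} c = trans
  (regroup (ind (c root)) (weight (c ∘ left)) (weight (c ∘ right)) _ _ _)
  (cong₂ _+_ (ind-not (c root)) (cong₂ _+_ (weight-complement (c ∘ left)) (weight-complement (c ∘ right))))
  where
  regroup : ∀ i a b j x y → (i + (a + b)) + (j + (x + y)) ≡ (i + j) + ((a + x) + (b + y))
  regroup = solve-∀

-- Here `m` counts the subtrees at depth `p` whose roots belong to the set. By `differ-banded` each
-- of these `2 ^ p` subtrees is almost monochromatic; the term `2 ^ p` covers the nodes above them.
near-multiple : ∀ p g {a} (c : Node (p + (g + a)) → Bool) → (∀ i → i < g → level (p + i) c ≡ 0) →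
  ∃[ m ] m * size (g + a) < weight c + (2 ^ p + cuts c * size a)
       × weight c < m * size (g + a) + (2 ^ p + cuts c * size a)
near-multiple zero g {a} c quiet with c root | differ-banded g c quiet
... | false | few = 0 , <-≤-trans (s≤s z≤n) (m≤n+m _ (weight c)) , s≤s few
... | true  | few = 1 ,
  (begin-strict
    1 * size (g + a)         ≡⟨ *-identityˡ _ ⟩
    size (g + a)             ≡⟨ weight-complement c ⟨
    weight c + differ true c <⟨ +-monoʳ-< (weight c) (s≤s few) ⟩
    weight c + (1 + cuts c * size a) ∎) ,
  (begin-strict
    weight c             ≤⟨ weight≤size c ⟩
    size (g + a)         ≡⟨ *-identityˡ _ ⟨
    1 * size (g + a)     <⟨ m<m+n _ (s≤s z≤n) ⟩
    1 * size (g + a) + (1 + cuts c * size a) ∎)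
  where open ≤-Reasoning
near-multiple (suc p) g {a} c quiet
  with near-multiple p g (c ∘ left) (λ i i<g → m+n≡0⇒m≡0 _ (quiet i i<g))
     | near-multiple p g (c ∘ right) (λ i i<g → m+n≡0⇒n≡0 (level (p + i) (c ∘ left)) (quiet i i<g))
... | m , below , above | m′ , below′ , above′ = m + m′ ,
  (begin-strict
    (m + m′) * Q                          ≡⟨ *-distribʳ-+ Q m m′ ⟩
    m * Q + m′ * Q                        <⟨ +-mono-< below below′ ⟩
    (w + (2 ^ p + e * A)) + (w′ + (2 ^ p + e′ * A)) ≡⟨ regroup w w′ (2 ^ p) e e′ A ⟩
    (w + w′) + (2 * 2 ^ p + (e + e′) * A) ≤⟨ +-mono-≤ (m≤n+m (w + w′) (ind (c root))) error ⟩
    weight c + (2 * 2 ^ p + cuts c * A) ∎) ,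
  (begin
    -- Both inductive bounds are strict: one of the two units gained absorbs the root, the other
    -- keeps the sum strict.
    suc (ind (c root) + (w + w′))         ≤⟨ s≤s (+-monoˡ-≤ (w + w′) (ind≤1 (c root))) ⟩
    suc (suc (w + w′))                    ≡⟨ cong suc (+-suc w w′) ⟨
    suc w + suc w′                        ≤⟨ +-mono-≤ above above′ ⟩
    (m * Q + (2 ^ p + e * A)) + (m′ * Q + (2 ^ p + e′ * A)) ≡⟨ regroup (m * Q) (m′ * Q) (2 ^ p) e e′ A ⟩
    (m * Q + m′ * Q) + (2 * 2 ^ p + (e + e′) * A) ≡⟨ cong (_+ (2 * 2 ^ p + (e + e′) * A)) (*-distribʳ-+ Q m m′) ⟨
    (m + m′) * Q + (2 * 2 ^ p + (e + e′) * A) ≤⟨ +-monoʳ-≤ ((m + m′) * Q) error ⟩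
    (m + m′) * Q + (2 * 2 ^ p + cuts c * A) ∎)
  where
  open ≤-Reasoning
  Q = size (g + a)
  A = size a
  w = weight (c ∘ left)
  w′ = weight (c ∘ right)
  e = cuts (c ∘ left)
  e′ = cuts (c ∘ right)
  regroup : ∀ x y p e e′ a → (x + (p + e * a)) + (y + (p + e′ * a)) ≡ (x + y) + (2 * p + (e + e′) * a)
  regroup = solve-∀
  error : 2 * 2 ^ p + (e + e′) * A ≤ 2 * 2 ^ p + cuts c * A
  error = +-monoʳ-≤ (2 * 2 ^ p) (*-monoˡ-≤ A (m≤n+m (e + e′) (level 0 c)))

-- A band of levels without bichromatic edges

sumTo : ℕ → (ℕ → ℕ) → ℕ
sumTo n f = sum {n} (f ∘ toℕ)

sumTo-+ : ∀ m n f → sumTo (m + n) f ≡ sumTo m f + sumTo n (f ∘ (m +_))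
sumTo-+ m n f = trans (sum-++ m (f ∘ toℕ)) (cong₂ _+_
  (sum-cong-≗ {m} (λ i → cong f (toℕ-↑ˡ i n))) (sum-cong-≗ {n} (λ i → cong f (toℕ-↑ʳ m i))))

sumTo≡0 : ∀ n f → sumTo n f ≡ 0 → ∀ i → i < n → f i ≡ 0
sumTo≡0 (suc n) f eq zero    _         = m+n≡0⇒m≡0 (f 0) eq
sumTo≡0 (suc n) f eq (suc i) (s≤s i<n) = sumTo≡0 n (f ∘ suc) (m+n≡0⇒n≡0 (f 0) eq) i i<n

-- Pigeonhole: a band that is not quiet contributes at least 1 to the sum, and the sum is less than
-- the number of bands.
quiet-band : ∀ b g f → sumTo (b * g) f < b → ∃[ j ] j < b × (∀ i → i < g → f (j * g + i) ≡ 0)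
quiet-band (suc b) g f lt with sumTo g f in eq | subst (_< suc b) (sumTo-+ g (b * g) f) lt
... | zero  | _ = 0 , s≤s z≤n , sumTo≡0 g f eq
... | suc s | lt′ =
  let j , j<b , zeros = quiet-band b g (f ∘ (g +_)) (≤-<-trans (m≤n+m _ s) (s≤s⁻¹ lt′))
  in suc j , s≤s j<b , λ i i<g → trans (cong f (+-assoc g (j * g) i)) (zeros i i<g)

levels≤cuts : ∀ {h} n (c : Node h → Bool) → sumTo n (λ d → level d c) ≤ cuts c
levels≤cuts         zero    c = z≤n
levels≤cuts {zero}  (suc n) c = ≤-reflexive (Σℕ.sum-replicate-zero n)
levels≤cuts {suc h} (suc n) c = +-monoʳ-≤ (level 0 c) (begin
  sum (λ (d : Fin n) → level (toℕ d) (c ∘ left) + level (toℕ d) (c ∘ right))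
    ≡⟨ ∑-distrib-+ {n} (λ d → level (toℕ d) (c ∘ left)) (λ d → level (toℕ d) (c ∘ right)) ⟩
  sumTo n (λ d → level d (c ∘ left)) + sumTo n (λ d → level d (c ∘ right))
    ≤⟨ +-mono-≤ (levels≤cuts n (c ∘ left)) (levels≤cuts n (c ∘ right)) ⟩
  cuts (c ∘ left) + cuts (c ∘ right) ∎)
  where open ≤-Reasoning

suc-size : ∀ h → suc (size h) ≡ 2 ^ suc h
suc-size zero    = refl
suc-size (suc h) = trans (double (size h)) (cong (2 *_) (suc-size h))
  where
  double : ∀ n → suc (suc (n + n)) ≡ 2 * suc n
  double = solve-∀

n<2^n : ∀ n → n < 2 ^ n
n<2^n zero    = ≤-refl
n<2^n (suc n) = begin-strict
  suc n         ≤⟨ n<2^n n ⟩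
  2 ^ n         <⟨ m<m+n (2 ^ n) (m^n>0 2 n) ⟩
  2 ^ n + 2 ^ n ≡⟨ cong (2 ^ n +_) (+-identityʳ (2 ^ n)) ⟨
  2 ^ suc n ∎
  where open ≤-Reasoning

-- A third of a power of two is far from all multiples

3∤2^n : ∀ n → ¬ (3 ∣ 2 ^ n)
3∤2^n zero    d = contradiction (∣⇒≤ d) λ { (s≤s ()) }
3∤2^n (suc n) d = 3∤2^n n (coprime-divisor (toWitness {a? = coprime? 3 2} tt) d)

-- Both `3 * m * Q` and `P * Q` are close to `3 * X`. As `3 * m` differs from `P`, they are at least
-- `Q` apart, whereas the accumulated error `E` is at most `Q`. The two strict cases bound the error
-- on either side.
multiples-far-from-third : ∀ {P Q A e D m s X} → P * Q + P ≤ 3 * s → 3 * s ≤ P * Q + P + 3 →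
  s ≤ X → X < s + D → m * Q < X + (P + e * A) → X < m * Q + (P + e * A) →
  3 * m ≢ P → e ≤ 3 * D → P ≤ suc A → (9 * D + 8) * suc A ≤ suc Q → ⊥
multiples-far-from-third {P} {Q} {A} {e} {D} {m} {s} {X} 3s-low 3s-high s≤X X<s+D low high 3m≢P e≤3D P≤A A≪Q
  with <-cmp (3 * m) P
... | tri≈ _ eq _ = 3m≢P eq
... | tri> _ _ P<3m = <⇒≱ (+-cancelˡ-< (P * Q) Q E (begin-strict
    P * Q + Q                       ≡⟨ +-comm (P * Q) Q ⟩
    suc P * Q                       ≤⟨ *-monoˡ-≤ Q P<3m ⟩
    3 * m * Q                       ≡⟨ *-assoc 3 m Q ⟩
    3 * (m * Q)                     <⟨ *-monoʳ-< 3 low ⟩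
    3 * (X + (P + e * A))           ≡⟨ *-distribˡ-+ 3 X (P + e * A) ⟩
    3 * X + 3 * (P + e * A)         ≤⟨ +-monoˡ-≤ (3 * (P + e * A)) 3X-high ⟩
    (P * Q + P + 3 * D) + 3 * (P + e * A) ≡⟨ collect (P * Q) P D (e * A) ⟩
    P * Q + E ∎)) E≤Q
  where
  open ≤-Reasoning
  E = 4 * P + 3 * D + 3 * (e * A)
  collect : ∀ x P D y → (x + P + 3 * D) + 3 * (P + y) ≡ x + (4 * P + 3 * D + 3 * y)
  collect = solve-∀
  E≤Q : E ≤ Q
  E≤Q = s≤s⁻¹ (begin
    suc E ≤⟨ s≤s (+-mono-≤ (+-monoˡ-≤ (3 * D) (*-monoʳ-≤ 4 P≤A)) (*-monoʳ-≤ 3 (*-monoˡ-≤ A e≤3D))) ⟩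
    -- The added summand is exactly what is missing to `(9 * D + 8) * suc A`.
    suc (4 * suc A + 3 * D + 3 * (3 * D * A)) ≤⟨ m≤m+n _ (3 + 6 * D + 4 * A) ⟩
    suc (4 * suc A + 3 * D + 3 * (3 * D * A)) + (3 + 6 * D + 4 * A) ≡⟨ expand A D ⟩
    (9 * D + 8) * suc A ≤⟨ A≪Q ⟩
    suc Q ∎)
    where
    expand : ∀ A D → suc (4 * suc A + 3 * D + 3 * (3 * D * A)) + (3 + 6 * D + 4 * A) ≡ (9 * D + 8) * suc A
    expand = solve-∀
  3X-high : 3 * X ≤ P * Q + P + 3 * D
  3X-high = +-cancelʳ-≤ 3 _ _ (begin
    3 * X + 3               ≡⟨ three X ⟩
    3 * suc X               ≤⟨ *-monoʳ-≤ 3 X<s+D ⟩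
    3 * (s + D)             ≡⟨ *-distribˡ-+ 3 s D ⟩
    3 * s + 3 * D           ≤⟨ +-monoˡ-≤ (3 * D) 3s-high ⟩
    P * Q + P + 3 + 3 * D   ≡⟨ swap-last (P * Q + P) (3 * D) ⟩
    P * Q + P + 3 * D + 3 ∎)
    where
    three : ∀ x → 3 * x + 3 ≡ 3 * suc x
    three = solve-∀
    swap-last : ∀ x y → x + 3 + y ≡ x + y + 3
    swap-last = solve-∀
... | tri< 3m<P _ _ = <⇒≱ (+-cancelˡ-< (3 * (m * Q)) Q E (begin-strict
    3 * (m * Q) + Q                 ≡⟨ cong (_+ Q) (*-assoc 3 m Q) ⟨
    3 * m * Q + Q                   ≡⟨ +-comm (3 * m * Q) Q ⟩
    suc (3 * m) * Q                 ≤⟨ *-monoˡ-≤ Q 3m<P ⟩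
    P * Q                           ≤⟨ m≤m+n (P * Q) P ⟩
    P * Q + P                       ≤⟨ 3s-low ⟩
    3 * s                           ≤⟨ *-monoʳ-≤ 3 s≤X ⟩
    3 * X                           <⟨ *-monoʳ-< 3 high ⟩
    3 * (m * Q + (P + e * A))       ≡⟨ *-distribˡ-+ 3 (m * Q) (P + e * A) ⟩
    3 * (m * Q) + 3 * (P + e * A) ∎)) E≤Q
  where
  open ≤-Reasoning
  E = 3 * (P + e * A)
  E≤Q : E ≤ Q
  E≤Q = s≤s⁻¹ (begin
    suc E ≤⟨ s≤s (*-monoʳ-≤ 3 (+-mono-≤ P≤A (*-monoˡ-≤ A e≤3D))) ⟩
    suc (3 * (suc A + 3 * D * A)) ≤⟨ m≤m+n _ (4 + 9 * D + 5 * A) ⟩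
    suc (3 * (suc A + 3 * D * A)) + (4 + 9 * D + 5 * A) ≡⟨ expand A D ⟩
    (9 * D + 8) * suc A ≤⟨ A≪Q ⟩
    suc Q ∎)
    where
    expand : ∀ A D → suc (3 * (suc A + 3 * D * A)) + (4 + 9 * D + 5 * A) ≡ (9 * D + 8) * suc A
    expand = solve-∀

-- Choice of the constants and expansion

module Isoperimetry (D : ℕ) where

  -- Fewer than `3 * D` bichromatic edges leave one of `bands` bands quiet. A band of `gap` levels
  -- makes the subtrees at its top larger than those at its bottom by a factor `2 ^ gap`, which
  -- exceeds `9 * D + 8`. The further `suc (bands * gap)` levels make the subtrees below a band
  -- outweigh the nodes above it. Finally, `third` is the least integer above a third of
  -- `2 ^ suc height`.
  bands gap height third : ℕ
  bands  = 3 * D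
  gap    = 9 * D + 8
  height = bands * gap + suc (bands * gap)
  third  = suc (2 ^ suc height / 3)

  third-low : 2 ^ suc height < 3 * third
  third-low = begin-strict
    W                   ≡⟨ m≡m%n+[m/n]*n W 3 ⟩
    W % 3 + W / 3 * 3   <⟨ +-monoˡ-< (W / 3 * 3) (m%n<n W 3) ⟩
    3 + W / 3 * 3       ≡⟨ *-comm third 3 ⟩
    3 * third ∎
    where
    open ≤-Reasoning
    W = 2 ^ suc height

  third-high : 3 * third ≤ 2 ^ suc height + 3
  third-high = begin
    3 * third           ≡⟨ *-comm 3 third ⟩
    3 + W / 3 * 3       ≤⟨ +-monoʳ-≤ 3 (m/n*n≤m W 3) ⟩
    3 + W               ≡⟨ +-comm 3 W ⟩
    W + 3 ∎
    where
    open ≤-Reasoning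
    W = 2 ^ suc height

  4≤2^ : 4 ≤ 2 ^ suc height
  4≤2^ = ^-monoʳ-≤ 2 {2} {suc height} (s≤s (≤-trans (s≤s z≤n) (m≤n+m (suc (bands * gap)) (bands * gap))))

  2≤third : 2 ≤ third
  2≤third = *-cancelˡ-< 3 1 third (≤-trans 4≤2^ (<⇒≤ third-low))

  third≤size : third ≤ size height
  third≤size = *-cancelˡ-≤ 3 (+-cancelʳ-≤ 3 _ _ (begin
    3 * third + 3         ≤⟨ +-monoˡ-≤ 3 third-high ⟩
    W + 3 + 3             ≡⟨ +-assoc W 3 3 ⟩
    W + 6                 ≤⟨ +-monoʳ-≤ W (≤-trans (m≤n+m 6 2) (*-monoʳ-≤ 2 4≤2^)) ⟩
    W + 2 * W             ≡⟨ cong (3 *_) (suc-size height) ⟨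
    3 * suc (size height) ≡⟨ three (size height) ⟩
    3 * size height + 3 ∎))
    where
    open ≤-Reasoning
    W = 2 ^ suc height
    three : ∀ x → 3 * suc x ≡ 3 * x + 3
    three = solve-∀

  -- The height is a variable so that its decomposition at the band, the form of index in
  -- `near-multiple`, can be matched by `refl`.
  no-quiet-band : ∀ {h} (c : Node h → Bool) j a → h ≡ j * gap + (gap + a) → j * gap ≤ suc a →
    2 ^ suc h < 3 * third → 3 * third ≤ 2 ^ suc h + 3 →
    third ≤ weight c → weight c < third + D → cuts c ≤ 3 * D →
    ¬ (∀ i → i < gap → level (j * gap + i) c ≡ 0)
  no-quiet-band c j a refl p≤a low high large small few quiet =
    let m , below , above = near-multiple (j * gap) gap c quiet
    in multiples-far-from-third {P = 2 ^ p} {Q = size (gap + a)} {A = size a} {m = m}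
         (subst (_≤ 3 * third) W≡ (<⇒≤ low)) (subst (λ w → 3 * third ≤ w + 3) W≡ high)
         large small below above
         (λ eq → 3∤2^n p (divides m (trans (sym eq) (*-comm 3 m)))) few
         (subst (2 ^ p ≤_) (sym (suc-size a)) (^-monoʳ-≤ 2 p≤a))
         A≪Q
    where
    p = j * gap
    W≡ : 2 ^ suc (p + (gap + a)) ≡ 2 ^ p * size (gap + a) + 2 ^ p
    W≡ = begin
      2 ^ suc (p + (gap + a))          ≡⟨ cong (2 ^_) (+-suc p (gap + a)) ⟨
      2 ^ (p + suc (gap + a))          ≡⟨ ^-distribˡ-+-* 2 p (suc (gap + a)) ⟩
      2 ^ p * 2 ^ suc (gap + a)        ≡⟨ cong (2 ^ p *_) (suc-size (gap + a)) ⟨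
      2 ^ p * suc (size (gap + a))     ≡⟨ *-suc (2 ^ p) (size (gap + a)) ⟩
      2 ^ p + 2 ^ p * size (gap + a)   ≡⟨ +-comm (2 ^ p) _ ⟩
      2 ^ p * size (gap + a) + 2 ^ p ∎
      where open ≡-Reasoning
    A≪Q : (9 * D + 8) * suc (size a) ≤ suc (size (gap + a))
    A≪Q = begin
      gap * suc (size a)       ≤⟨ *-monoˡ-≤ (suc (size a)) (<⇒≤ (n<2^n gap)) ⟩
      2 ^ gap * suc (size a)   ≡⟨ cong (2 ^ gap *_) (suc-size a) ⟩
      2 ^ gap * 2 ^ suc a      ≡⟨ ^-distribˡ-+-* 2 gap (suc a) ⟨
      2 ^ (gap + suc a)        ≡⟨ cong (2 ^_) (+-suc gap a) ⟩
      2 ^ suc (gap + a)        ≡⟨ suc-size (gap + a) ⟨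
      suc (size (gap + a)) ∎
      where open ≤-Reasoning

  many-cuts : (c : Node height → Bool) → third ≤ weight c → weight c < third + D → 3 * D ≤ cuts c
  many-cuts c large small with 3 * D ≤? cuts c
  ... | yes many = many
  ... | no few =
    let j , j<b , quiet = quiet-band bands gap (λ d → level d c)
                            (≤-<-trans (levels≤cuts (bands * gap) c) (≰⇒> few))
        -- `t` is the number of bands below the quiet one.
        t , eq = m≤n⇒∃[o]m+o≡n j<b
    in contradiction quiet (no-quiet-band c j (t * gap + suc (bands * gap))
         (trans (cong (λ b → b * gap + suc (bands * gap)) (sym eq)) (split j t gap (suc (bands * gap))))
         -- At most `bands * gap` levels lie above the quiet band, and the extra levels of `height`
         -- below all bands exceed this.
         (m≤n⇒m≤1+n (≤-trans (*-monoˡ-≤ gap (<⇒≤ j<b)) (≤-trans (n≤1+n _) (m≤n+m _ (t * gap)))))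
         third-low third-high large small (<⇒≤ (≰⇒> few)))
    where
    split : ∀ j t g x → (suc j + t) * g + x ≡ j * g + (g + (t * g + x))
    split = solve-∀

  -- If `S` already has `third + D` nodes, nothing has to be gained. Otherwise it has at least
  -- `3 * D` bichromatic edges, and each node gained accounts for at most three of them.
  expansion : (S U : Node height → Bool) → (∀ x → T (S x) → T (U x)) →
    (∀ x y → Child x y → T (S x) → T (U y)) → (∀ x y → Child x y → T (S y) → T (U x)) →
    third ≤ weight S → third + D ≤ weight U
  expansion S U S⊆U down up large with third + D ≤? weight S
  ... | yes huge = ≤-trans huge (weight-mono S U S⊆U)
  ... | no small = *-cancelˡ-≤ 3 (begin
    3 * (third + D)         ≡⟨ *-distribˡ-+ 3 third D ⟩
    3 * third + 3 * D       ≤⟨ +-mono-≤ (*-monoʳ-≤ 3 large) (many-cuts S large (≰⇒> small)) ⟩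
    3 * weight S + cuts S   ≡⟨ +-comm (3 * weight S) (cuts S) ⟩
    cuts S + 3 * weight S   ≤⟨ m≤m+n _ _ ⟩
    (cuts S + 3 * weight S) + ind (U root ∧ not (S root)) ≤⟨ cuts-boundary S U S⊆U down up ⟩
    3 * weight U ∎)
    where open ≤-Reasoning

-- The robber evades `d` cops on the tree

count-index : ∀ {h} (S : Fin (size h) → Bool) → count S ≡ weight (S ∘ index {h})
count-index {h} S = trans
  (sum-cong-≗ (λ i → cong (ind ∘ S) (sym (index-node {h} i))))
  (sum-node (ind ∘ S ∘ index {h}))

module _ (k d : ℕ) where

  -- This is the number of candidates that `d` cops can rule out in one round.
  open Isoperimetry (d * ballBound k)
  open LocalizationGame k (binaryTree-connected height) using (Move; CopsWin)
  open Positions k (binaryTree-connected height) using (module Evasion)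

  move-expands : (S S′ : Fin (size height) → Bool) → (∀ x y → T (S x) → Move x y → T (S′ y)) →
                 third ≤ count S → third + d * ballBound k ≤ count S′
  move-expands S S′ spread large = subst (third + d * ballBound k ≤_) (sym (count-index {height} S′))
    (expansion (S ∘ index) (S′ ∘ index)
      (λ x t → spread _ _ t (inj₁ refl))
      (λ x y c t → spread _ _ t (inj₂ (inj₁ (link c))))
      (λ x y c t → spread _ _ t (inj₂ (inj₂ (link c))))
      (subst (third ≤_) (count-index {height} S) large))
    where
    link : ∀ {x y : Node height} → Child x y → Child (node {height} (index x)) (node (index y))
    link {x} {y} = subst₂ Child (sym (node-index x)) (sym (node-index y))

  few-cops-lose : ∀ {m} → m ≤ d → ¬ CopsWin m
  few-cops-lose m≤d = cops-lose (*-monoˡ-≤ (ballBound k) m≤d) third≤size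
    where
    open Evasion (ballBound k) third (d * ballBound k)
      (ball-count {height} k (binaryTree-connected height)) move-expands 2≤third

theorem6 : (k d : ℕ) → 0 < d →
    Σ[ T ∈ Graph ] Σ[ tree ∈ IsTree T ] Σ[ m ∈ ℕ ]
    (IsLocalizationNumber k (IsTree.isConnected tree) m × d < m)
theorem6 k d _ =
  let m , least@((_ , win) , _) = Positions.localizationNumber k (binaryTree-connected height)
  in binaryTree height , binaryTree-isTree height , m , least , ≰⇒> (λ m≤d → few-cops-lose k d m≤d win)
  where open Isoperimetry (d * ballBound k) using (height)
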